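{- There is an absolute constant $c$ (depending only on the constants in the time bounds of the priority queue implementation) such that the following holds. Let $\Sigma$ be a finite nonempty set, let $S=\{p_x\}_{x\in\Sigma}$ be a monotone precedence system on $\Sigma$, and let $\pi\in\mathcal{P}(S)$. Then the queue time $t^{\mathrm{Q}}$ of topological heapsort on input $(\Sigma,S,\pi)$ satisfies $t^{\mathrm{Q}}\le c\,(|\Sigma|+\log|\mathcal{P}(S)|)$; that is, $t^{\mathrm{Q}}\in\mathcal{O}(|\Sigma|+\log|\mathcal{P}(S)|)$.
   Context: Words and permutations. $\Sigma$ is a finite set of letters; a simple word is a finite sequence of pairwise distinct letters; the support $\tilde\alpha$ of a word $\alpha$ is the set of its letters; a permutation of $\Sigma$ is a simple word containing every letter exactly once, identified with the total order $\prec_\pi$ in which $x\prec_\pi y$ iff $x$ precedes $y$ in $\pi$. Logarithms are base 2. Monotone precedence systems. A precedence function for $x\in\Sigma$ is a function $p_x\colon 2^{\Sigma\setminus\{x\}}\to\{0,1\}$ with $p_x(X)\le p_x(Y)$ whenever $X\subseteq Y\subseteq\Sigma\setminus\{x\}$. A monotone precedence system (MPS) on $\Sigma$ is a collection $S=\{p_x\}_{x\in\Sigma}$ of precedence functions. Its language $\mathcal{L}(S)$ is the set of simple words $x_1x_2\dots x_k$ with $p_{x_i}(\{x_1,\dots,x_{i-1}\})=1$ for all $i\in[k]$, and $\mathcal{P}(S)$ is the set of permutations of $\Sigma$ contained in $\mathcal{L}(S)$. Topological heapsort on input $(\Sigma,S,\pi)$, where $\pi\in\mathcal{P}(S)$ is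 accessed only through constant-time queries of the form "$x\prec_\pi y$?": Initialize a working-set priority queue $Q$ (ordered by $\prec_\pi$) containing each $x\in\Sigma$ with $p_x(\emptyset)=1$, and set $\alpha$ to the empty word. While $Q$ is not empty: delete the minimum from $Q$ and append it to $\alpha$; then, for each $x\in\Sigma$ that is neither in $\tilde\alpha$ nor in $Q$, insert $x$ into $Q$ if $p_x(\tilde\alpha)=1$. Finally return $\alpha$. Queue time. $t^{\mathrm{Q}}$ is the total time spent by the operations on $Q$: initializing $Q$ with the (given) initial elements, deleting minima, and inserting (given) elements. The time for determining which elements have to be inserted is not counted. Working-set priority queue. This is a comparison-based priority queue with operations insert and extract-min such that, in any sequence of operations starting from an empty queue in which each element is inserted at most once, insert takes amortized time $\mathcal{O}(1)$ and an extract-min returning $x$ takes amortized time $\mathcal{O}(1+\log w(x))$, where $w(x)$ is the number of elements inserted into the queue while $x$ is present, counting $x$ itself (the "weak working-set property"). Initializing the queue with a set amounts to inserting its elements one by one. -}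

module Defs where

open import Data.Bool.Base as Bool using (Bool; true; T; if_then_else_)
open import Data.Fin.Base using (Fin; toℕ)
open import Data.Fin.Properties using (_≟_; all?)
open import Data.Fin.Subset as Subset using (Subset; ⋃; ⁅_⁆)
open import Data.List.Base
  using (List; []; _∷_; _∷ʳ_; [_]; map; length; lookup; take; foldl; filter;
         allFin; cartesianProductWith)
open import Data.List.Membership.Propositional using (_∈_; _∉_)
open import Data.List.Relation.Unary.Unique.Propositional using (Unique)
open import Data.Maybe.Base as Maybe using (Maybe; just; nothing)
open import Data.Nat.Base using (ℕ; zero; suc; _+_; _*_; _^_; _≤_)
open import Data.Product.Base using (_×_; _,_)
open import Function.Bundles using (_⇔_)
open import Relation.Binary.PropositionalEquality using (_≡_; _≢_)
open import Relation.Binary.Structures using (IsStrictTotalOrder)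
open import Relation.Nullary using (¬_; Dec; does; _×-dec_)
import Data.Bool.Properties as Boolₚ
import Data.List.Membership.DecPropositional as DecMembership
import Data.List.Relation.Binary.Sublist.DecPropositional as DecSublist
import Data.List.Relation.Unary.Unique.DecPropositional as DecUnique

------------------------------------------------------------------------
-- Base-2 logarithms

-- The real number log₂ m is represented by m itself.  Sums, natural
-- multiples and inequalities of such numbers are then exact, without
-- rounding:
--   log₂ m + log₂ n = log₂ (m n),   c · log₂ m = log₂ (m ^ c),
--   k = log₂ (2 ^ k),               log₂ m ≤ log₂ n  iff  m ≤ n.
-- (log₂ 0 is a least element, "-∞"; it is never taken below on the
-- inputs considered.)

record Logarithm : Set where
  constructor log₂
  field
    antilog : ℕ

open Logarithm public

infix  4 _≤ᴸ_
infixl 6 _+ᴸ_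
infixr 7 _·_

_+ᴸ_ : Logarithm → Logarithm → Logarithm
log₂ m +ᴸ log₂ n = log₂ (m * n)

_·_ : ℕ → Logarithm → Logarithm
c · log₂ m = log₂ (m ^ c)

fromℕ : ℕ → Logarithm
fromℕ k = log₂ (2 ^ k)

_≤ᴸ_ : Logarithm → Logarithm → Set
x ≤ᴸ y = antilog x ≤ antilog y

------------------------------------------------------------------------
-- Words and permutations over the alphabet Fin n

Word : ℕ → Set
Word n = List (Fin n)

support : ∀ {n} → Word n → Subset n
support α = ⋃ (map ⁅_⁆ α)

IsPermutation : ∀ {n} → Word n → Set
IsPermutation π = Unique π × (∀ x → x ∈ π)

-- In a simple word, x precedes y iff the word x y is a subsequence.
precedes : ∀ {n} → Word n → Fin n → Fin n → Bool
precedes π x y = does ((x ∷ y ∷ []) ⊆? π)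
  where open DecSublist _≟_ using (_⊆?_)

------------------------------------------------------------------------
-- Monotone precedence systems

-- A precedence function for x is defined on the subsets not containing
-- x.  Here p x is a total function whose values on the other subsets
-- are unconstrained; they are never used.
record MPS (n : ℕ) : Set where
  field
    p        : Fin n → Subset n → Bool
    monotone : ∀ x X Y → X Subset.⊆ Y → x Subset.∉ Y → p x X Bool.≤ p x Y

open MPS public

infix 4 _∈ℒ_ _∈𝒫_ _∈𝒫?_

_∈ℒ_ : ∀ {n} → Word n → MPS n → Set
α ∈ℒ S = Unique α ×
  (∀ i → p S (lookup α i) (support (take (toℕ i) α)) ≡ true)

_∈𝒫_ : ∀ {n} → Word n → MPS n → Set
α ∈𝒫 S = IsPermutation α × α ∈ℒ S

_∈𝒫?_ : ∀ {n} (α : Word n) (S : MPS n) → Dec (α ∈𝒫 S)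
α ∈𝒫? S =
  (unique? α ×-dec all? (λ x → x ∈? α)) ×-dec
  (unique? α ×-dec all? (λ i → p S (lookup α i) _ Boolₚ.≟ true))
  where
  open DecUnique _≟_ using (unique?)
  open DecMembership _≟_ using (_∈?_)

words : ∀ n → ℕ → List (Word n)
words n zero    = [ [] ]
words n (suc k) = cartesianProductWith _∷_ (allFin n) (words n k)

-- Every permutation of Fin n occurs exactly once in words n n.
∣𝒫_∣ : ∀ {n} → MPS n → ℕ
∣𝒫_∣ {n} S = length (filter (_∈𝒫? S) (words n n))

------------------------------------------------------------------------
-- Comparison-based computations

-- The keys can only be ordered by queries "x ≺ y?", each taking one unit
-- of time; tick accounts for a unit of time spent on anything else.
data Comp (A X : Set) : Set where
  return  : X → Comp A X
  tick    : Comp A X → Comp A X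
  compare : A → A → (Bool → Comp A X) → Comp A X

result : ∀ {A X} → (A → A → Bool) → Comp A X → X
result lt (return v)      = v
result lt (tick m)        = result lt m
result lt (compare x y k) = result lt (k (lt x y))

duration : ∀ {A X} → (A → A → Bool) → Comp A X → ℕ
duration lt (return v)      = 0
duration lt (tick m)        = suc (duration lt m)
duration lt (compare x y k) = suc (duration lt (k (lt x y)))

StrictTotal : ∀ {A : Set} → (A → A → Bool) → Set
StrictTotal lt = IsStrictTotalOrder _≡_ (λ x y → T (lt x y))

------------------------------------------------------------------------
-- Priority queues

record PriorityQueue (A : Set) : Set₁ where
  field
    State      : Set
    empty      : State
    insert     : A → State → Comp A State
    extractMin : State → Comp A (Maybe (A × State))

data Event (A : Set) : Set where
  inserted  : A → Event A
  extracted : A → Event A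

-- Most recent event first.
History : Set → Set
History A = List (Event A)

insertions : ∀ {A} → History A → List A
insertions []                = []
insertions (inserted x  ∷ h) = x ∷ insertions h
insertions (extracted x ∷ h) = insertions h

-- The contents of the queue, when each element is inserted at most once.
Present : ∀ {A} → History A → A → Set
Present h x = inserted x ∈ h × extracted x ∉ h

-- For x present after h, the number of elements inserted since the
-- insertion of x, including x.
workingSet : ∀ {n} → History (Fin n) → Fin n → ℕ
workingSet []                x = 0
workingSet (inserted y  ∷ h) x =
  if does (x ≟ y) then 1 else suc (workingSet h x)
workingSet (extracted y ∷ h) x = workingSet h x

-- A queue in use, with its past operations and the total time they took.
record Configuration {A} (Q : PriorityQueue A) : Set where
  constructor config
  field
    state   : PriorityQueue.State Q
    history : History A
    time    : ℕ

open Configuration public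

module _ {A} {Q : PriorityQueue A} where

  private module Q = PriorityQueue Q

  new : Configuration Q
  new = config Q.empty [] 0

  insert : (A → A → Bool) → Configuration Q → A → Configuration Q
  insert lt (config s h t) x =
    config (result lt op) (inserted x ∷ h) (t + duration lt op)
    where op = Q.insert x s

  insertAll : (A → A → Bool) → Configuration Q → List A → Configuration Q
  insertAll lt = foldl (insert lt)

  extractMin : (A → A → Bool) → Configuration Q → Maybe (A × Configuration Q)
  extractMin lt (config s h t) = Maybe.map
    (λ (x , s′) → x , config s′ (extracted x ∷ h) (t + duration lt op))
    (result lt op)
    where op = Q.extractMin s

  data Reachable (lt : A → A → Bool) : Configuration Q → Set where
    start     : Reachable lt new
    insertion : ∀ {C} x → Reachable lt C → Reachable lt (insert lt C x)
    deletion  : ∀ {C x C′} → Reachable lt C →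
                extractMin lt C ≡ just (x , C′) → Reachable lt C′

record IsPriorityQueue {A} (Q : PriorityQueue A) : Set where
  field
    minimum : ∀ {lt} → StrictTotal lt →
      ∀ {C : Configuration Q} → Reachable lt C → Unique (insertions (history C)) →
      ∀ {x C′} → extractMin lt C ≡ just (x , C′) →
      Present (history C) x ×
      (∀ y → Present (history C) y → y ≢ x → T (lt x y))
    exhausted : ∀ {lt} → StrictTotal lt →
      ∀ {C : Configuration Q} → Reachable lt C → Unique (insertions (history C)) →
      extractMin lt C ≡ nothing → ∀ y → ¬ Present (history C) y

amortized : ∀ {n} → ℕ → ℕ → History (Fin n) → Logarithm
amortized a b []                = fromℕ 0
amortized a b (inserted x  ∷ h) = amortized a b h +ᴸ fromℕ a
amortized a b (extracted x ∷ h) =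
  amortized a b h +ᴸ b · (fromℕ 1 +ᴸ log₂ (workingSet h x))

-- Insertions take amortized time at most a, and extracting x takes
-- amortized time at most b (1 + log w(x)).
WeakWorkingSetProperty : ∀ {n} → PriorityQueue (Fin n) → ℕ → ℕ → Set
WeakWorkingSetProperty Q a b =
  ∀ {lt} → StrictTotal lt →
  ∀ {C : Configuration Q} → Reachable lt C → Unique (insertions (history C)) →
  fromℕ (time C) ≤ᴸ amortized a b (history C)

------------------------------------------------------------------------
-- Topological heapsort

-- xs lists the elements satisfying P once each, in an arbitrary order.
Enumerates : ∀ {A : Set} → List A → (A → Set) → Set
Enumerates xs P = Unique xs × (∀ x → x ∈ xs ⇔ P x)

-- AtLoopHead Q S π α C: the algorithm can reach the test of the while
-- loop with word α and queue C.  The order in which the letters are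
-- scanned for insertion is left open, both initially and in each
-- iteration.
data AtLoopHead {n} (Q : PriorityQueue (Fin n)) (S : MPS n) (π : Word n) :
                Word n → Configuration Q → Set where
  initialize : ∀ {xs} →
    Enumerates xs (λ x → p S x (support []) ≡ true) →
    AtLoopHead Q S π [] (insertAll (precedes π) new xs)
  iterate : ∀ {α C x C′ ys} →
    AtLoopHead Q S π α C →
    extractMin (precedes π) C ≡ just (x , C′) →
    Enumerates ys (λ y → y ∉ α ∷ʳ x × ¬ Present (history C′) y ×
                         p S y (support (α ∷ʳ x)) ≡ true) →
    AtLoopHead Q S π (α ∷ʳ x) (insertAll (precedes π) C′ ys)

-- A complete execution, returning α and leaving the queue as C.
Heapsort : ∀ {n} (Q : PriorityQueue (Fin n)) → MPS n → Word n →
           Word n → Configuration Q → Set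
Heapsort Q S π α C = AtLoopHead Q S π α C × (∀ x → ¬ Present (history C) x)

{-# OPTIONS --safe #-}
-- Moving the extraction of a letter x to an earlier moment at which x was
-- already in the queue yields, by monotonicity, again a valid execution.  In
-- particular the extraction of x can be placed just after any of the w(x)
-- insertions made while x is present, and these choices are independent for
-- different x, so they produce ∏ w(x) distinct valid histories.  All of them
-- make the same insertions in the same order, so a history is determined by its
-- extraction order, an element of 𝒫(S), and by its pattern of insertions and
-- extractions, a word of 2n bits.  Hence ∏ w(x) ≤ |𝒫(S)| · 4 ^ n.

module Submission where

open import Defs
open import Data.Bool.Base using (Bool; true; false; T; if_then_else_)
open import Data.Empty using (⊥-elim)
open import Data.Fin.Base using (Fin; zero; suc; toℕ)
open import Data.Fin.Properties using (_≟_)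
import Data.Fin.Subset as Subset
import Data.Fin.Subset.Properties as Subsetₚ
open import Data.List.Base
  using (List; []; _∷_; _∷ʳ_; [_]; _++_; map; length; lookup; take; filter;
         reverse; concatMap; cartesianProduct; cartesianProductWith; allFin)
open import Data.List.Membership.Propositional using (_∈_; _∉_)
open import Data.List.Membership.Propositional.Properties
open import Data.List.Properties
  using (length-++; length-map; length-tabulate; ∷-injective;
         unfold-reverse; reverse-injective)
open import Data.List.Relation.Binary.Permutation.Propositional as Perm
  using (_↭_; ↭-refl; ↭-trans; ↭-sym; prep; swap)
open import Data.List.Relation.Binary.Permutation.Propositional.Properties
  using (∈-resp-↭; ↭-length; ↭-reverse)
open import Data.List.Relation.Binary.Sublist.Propositional as Sublist
  using (_∷_; []) renaming (_⊆_ to _⊑_; _∷ʳ_ to _skip_)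
import Data.List.Relation.Binary.Permutation.Setoid.Properties as PermSetoid
open import Data.List.Relation.Unary.All as All using (All; []; _∷_)
open import Data.List.Relation.Unary.Any using (here; there)
open import Data.List.Relation.Unary.AllPairs using ([]; _∷_)
open import Data.List.Relation.Unary.Unique.Propositional using (Unique)
import Data.List.Relation.Unary.Unique.Propositional.Properties as Uniqueₚ
open import Data.Maybe.Base using (just)
open import Data.Nat.Base using (ℕ; zero; suc; _+_; _*_; _^_; _≤_; z≤n; s≤s; NonZero)
open import Data.Nat.Properties hiding (_≟_)
open import Data.Nat.Solver using (module +-*-Solver)
open import Data.Product.Base using (_×_; _,_; ∃-syntax; proj₁; proj₂)
open import Data.Sum.Base using (_⊎_; inj₁; inj₂; [_,_]′)
open import Function.Base using (_∘_; id)
open import Function.Bundles using (Equivalence)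
open import Relation.Binary.Definitions using (tri<; tri≈; tri>)
open import Relation.Binary.PropositionalEquality hiding ([_])
open import Relation.Nullary using (¬_; Dec; yes; no; does)
import Data.List.Membership.DecPropositional as DecMembership

^-distribʳ-* : ∀ o m n → (m * n) ^ o ≡ m ^ o * n ^ o
^-distribʳ-* zero    m n = refl
^-distribʳ-* (suc o) m n rewrite ^-distribʳ-* o m n =
  solve 4 (λ m n u v → (m :* n) :* (u :* v) := (m :* u) :* (n :* v)) refl m n (m ^ o) (n ^ o)
  where open +-*-Solver

-- Counting lists

module _ {A : Set} where

  Unique-resp-↭ : ∀ {xs ys : List A} → xs ↭ ys → Unique xs → Unique ys
  Unique-resp-↭ xs↭ys = PermSetoid.Unique-resp-↭ (setoid A) (Perm.↭⇒↭ₛ xs↭ys)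

  ∈-delete : ∀ {y z : A} us {vs} → y ∈ us ++ z ∷ vs → y ≢ z → y ∈ us ++ vs
  ∈-delete us y∈ y≢z with ∈-++⁻ us y∈
  ... | inj₁ y∈us         = ∈-++⁺ˡ y∈us
  ... | inj₂ (here y≡z)   = ⊥-elim (y≢z y≡z)
  ... | inj₂ (there y∈vs) = ∈-++⁺ʳ us y∈vs

  length-concatMap : ∀ {B : Set} (f : A → List B) k {xs} →
    (∀ {x} → x ∈ xs → length (f x) ≡ k) → length (concatMap f xs) ≡ length xs * k
  length-concatMap f k {[]}     eq = refl
  length-concatMap f k {x ∷ xs} eq = trans (length-++ (f x))
    (cong₂ _+_ (eq (here refl)) (length-concatMap f k (eq ∘ there)))

  ∈-concatMap⇒∃ : ∀ {B : Set} (f : A → List B) xs {y} → y ∈ concatMap f xs →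
    ∃[ x ] (x ∈ xs × y ∈ f x)
  ∈-concatMap⇒∃ f (x ∷ xs) y∈ with ∈-++⁻ (f x) y∈
  ... | inj₁ y∈fx = x , here refl , y∈fx
  ... | inj₂ y∈xs with x′ , x′∈ , y∈′ ← ∈-concatMap⇒∃ f xs y∈xs = x′ , there x′∈ , y∈′

  -- The map `g` recovers from an element the block in which it lies, so blocks of distinct indices
  -- are disjoint.
  Unique-concatMap : ∀ {B : Set} (f : A → List B) (g : B → A) {xs} → Unique xs →
    (∀ {x} → x ∈ xs → Unique (f x)) →
    (∀ {x y} → x ∈ xs → y ∈ f x → g y ≡ x) → Unique (concatMap f xs)
  Unique-concatMap f g []                        uf inv = []
  Unique-concatMap f g {x ∷ xs} (x∉xs ∷ uxs) uf inv =
    Uniqueₚ.++⁺ (uf (here refl)) (Unique-concatMap f g uxs (uf ∘ there) (inv ∘ there))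
      λ (y∈fx , y∈rest) → let x′ , x′∈xs , y∈fx′ = ∈-concatMap⇒∃ f xs y∈rest in
        All.lookup x∉xs x′∈xs
          (trans (sym (inv (here refl) y∈fx)) (inv (there x′∈xs) y∈fx′))

-- One occurrence of `f x` is cut out of `ys`. By injectivity the images of the remaining elements
-- differ from `f x`, so they survive the cut and the induction continues.
injection⇒length≤ : ∀ {A B : Set} (f : A → B) {xs ys} → Unique xs →
  (∀ {x} → x ∈ xs → f x ∈ ys) →
  (∀ {x y} → x ∈ xs → y ∈ xs → f x ≡ f y → x ≡ y) →
  length xs ≤ length ys
injection⇒length≤ f [] _ _ = z≤n
injection⇒length≤ f {x ∷ xs} (x∉xs ∷ uxs) into inj
  with us , vs , refl ← ∈-∃++ (into (here refl)) = begin
    suc (length xs)            ≤⟨ s≤s (injection⇒length≤ f uxs into′ inj′) ⟩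
    suc (length (us ++ vs))    ≡⟨ cong suc (length-++ us) ⟩
    suc (length us + length vs) ≡⟨ +-suc (length us) (length vs) ⟨
    length us + suc (length vs) ≡⟨ length-++ us ⟨
    length (us ++ f x ∷ vs)    ∎
  where
  open ≤-Reasoning
  inj′ : ∀ {y z} → y ∈ xs → z ∈ xs → f y ≡ f z → y ≡ z
  inj′ y∈ z∈ = inj (there y∈) (there z∈)
  into′ : ∀ {y} → y ∈ xs → f y ∈ us ++ vs
  into′ y∈xs = ∈-delete us (into (there y∈xs))
    λ fy≡fx → All.lookup x∉xs y∈xs (inj (here refl) (there y∈xs) (sym fy≡fx))

length-cartesianProductWith : ∀ {A B C : Set} (f : A → B → C) xs ys →
  length (cartesianProductWith f xs ys) ≡ length xs * length ys
length-cartesianProductWith f []       ys = refl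
length-cartesianProductWith f (x ∷ xs) ys = trans (length-++ (map (f x) ys))
  (cong₂ _+_ (length-map (f x) ys) (length-cartesianProductWith f xs ys))

length-words : ∀ n k → length (words n k) ≡ n ^ k
length-words n zero    = refl
length-words n (suc k) = trans (length-cartesianProductWith _∷_ (allFin n) (words n k))
  (cong₂ _*_ (length-tabulate {n = n} id) (length-words n k))

∈-words : ∀ {n} (w : Word n) → w ∈ words n (length w)
∈-words []      = here refl
∈-words (x ∷ w) = ∈-cartesianProductWith⁺ _∷_ (∈-allFin x) (∈-words w)

Unique⇒length≤ : ∀ {n} {w : Word n} → Unique w → length w ≤ n
Unique⇒length≤ {n} {w} uw = subst (length w ≤_) (length-tabulate {n = n} id)
  (injection⇒length≤ id uw (λ {x} _ → ∈-allFin x) (λ _ _ → id))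

-- Words as precedence orders

∈-support⁺ : ∀ {n} {x : Fin n} {w} → x ∈ w → x Subset.∈ support w
∈-support⁺ {x = x} (here refl) = Subsetₚ.x∈p∪q⁺ (inj₁ (Subsetₚ.x∈⁅x⁆ x))
∈-support⁺ (there x∈w)         = Subsetₚ.x∈p∪q⁺ (inj₂ (∈-support⁺ x∈w))

∈-support⁻ : ∀ {n} {x : Fin n} w → x Subset.∈ support w → x ∈ w
∈-support⁻ []      x∈ = ⊥-elim (Subsetₚ.∉⊥ x∈)
∈-support⁻ (y ∷ w) x∈ with Subsetₚ.x∈p∪q⁻ Subset.⁅ y ⁆ (support w) x∈
... | inj₁ x∈y = here (Subsetₚ.x∈⁅y⁆⇒x≡y y x∈y)
... | inj₂ x∈w = there (∈-support⁻ w x∈w)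

T-does⁺ : ∀ {A : Set} (d : Dec A) → A → T (does d)
T-does⁺ (yes _) _ = _
T-does⁺ (no ¬a) a = ⊥-elim (¬a a)

T-does⁻ : ∀ {A : Set} (d : Dec A) → T (does d) → A
T-does⁻ (yes a) _ = a

module _ {A : Set} where

  ⊑⇒∈ : ∀ {x : A} {us w} → x ∷ us ⊑ w → x ∈ w
  ⊑⇒∈ x⊑w = Sublist.lookup x⊑w (here refl)

  ⊑⇒∈₂ : ∀ {x y : A} {w} → x ∷ y ∷ [] ⊑ w → y ∈ w
  ⊑⇒∈₂ xy⊑w = Sublist.lookup xy⊑w (there (here refl))

  precedes-irrefl : ∀ {x : A} {w} → Unique w → ¬ (x ∷ x ∷ [] ⊑ w)
  precedes-irrefl (_ ∷ uw)   (_ skip xx⊑w)   = precedes-irrefl uw xx⊑w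
  precedes-irrefl (x∉w ∷ uw) (refl ∷ x⊑w) = All.lookup x∉w (⊑⇒∈ x⊑w) refl

  -- In a simple word `y` has a single position, where the two embeddings meet. The two absurd cases
  -- are those in which `y` is the head and occurs again in the tail.
  precedes-trans : ∀ {x y z : A} {w} → Unique w →
    x ∷ y ∷ [] ⊑ w → y ∷ z ∷ [] ⊑ w → x ∷ z ∷ [] ⊑ w
  precedes-trans (_ ∷ uw)   (_ skip xy)   (_ skip yz)   = _ skip precedes-trans uw xy yz
  precedes-trans (y∉w ∷ uw) (_ skip xy)   (refl ∷ z) = ⊥-elim (All.lookup y∉w (⊑⇒∈₂ xy) refl)
  precedes-trans (_ ∷ uw)   (refl ∷ y) (_ skip yz)   = refl ∷ Sublist.from∈ (⊑⇒∈₂ yz)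
  precedes-trans (y∉w ∷ uw) (refl ∷ y) (refl ∷ z) = ⊥-elim (All.lookup y∉w (⊑⇒∈ y) refl)

  precedes-connex : ∀ {x y : A} {w} → x ≢ y → x ∈ w → y ∈ w →
    (x ∷ y ∷ [] ⊑ w) ⊎ (y ∷ x ∷ [] ⊑ w)
  precedes-connex x≢y (here refl) (here refl) = ⊥-elim (x≢y refl)
  precedes-connex x≢y (here refl) (there y∈w) = inj₁ (refl ∷ Sublist.from∈ y∈w)
  precedes-connex x≢y (there x∈w) (here refl) = inj₂ (refl ∷ Sublist.from∈ x∈w)
  precedes-connex x≢y (there x∈w) (there y∈w) with precedes-connex x≢y x∈w y∈w
  ... | inj₁ xy = inj₁ (_ skip xy)
  ... | inj₂ yx = inj₂ (_ skip yx)

precedes-strictTotal : ∀ {n} {π : Word n} → IsPermutation π → StrictTotal (precedes π)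
precedes-strictTotal {n} {π} (uπ , full) = record
  { isStrictPartialOrder = record
    { isEquivalence = isEquivalence
    ; irrefl        = λ { {x} refl → irrefl {x} }
    ; trans         = λ {x} {y} {z} → trans-≺ {x} {y} {z}
    ; <-resp-≈      = resp₂ _≺_
    }
  ; compare = compare-≺
  }
  where
  open import Data.List.Relation.Binary.Sublist.DecPropositional (_≟_ {n}) using (_⊆?_)
  _≺_ : Fin n → Fin n → Set
  x ≺ y = T (precedes π x y)
  to : ∀ {x y} → x ∷ y ∷ [] ⊑ π → x ≺ y
  to {x} {y} = T-does⁺ (x ∷ y ∷ [] ⊆? π)
  from : ∀ {x y} → x ≺ y → x ∷ y ∷ [] ⊑ π
  from {x} {y} = T-does⁻ (x ∷ y ∷ [] ⊆? π)
  irrefl : ∀ {x} → ¬ (x ≺ x)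
  irrefl x≺x = precedes-irrefl uπ (from x≺x)
  trans-≺ : ∀ {x y z} → x ≺ y → y ≺ z → x ≺ z
  trans-≺ x≺y y≺z = to (precedes-trans uπ (from x≺y) (from y≺z))
  asym-≺ : ∀ {x y} → x ≺ y → ¬ (y ≺ x)
  asym-≺ x≺y y≺x = irrefl (trans-≺ x≺y y≺x)
  compare-≺ : ∀ x y → _
  compare-≺ x y with x ≟ y
  ... | yes refl = tri≈ (irrefl {x}) refl (irrefl {x})
  ... | no x≢y with precedes-connex x≢y (full x) (full y)
  ...   | inj₁ xy = tri< (to xy) x≢y (asym-≺ (to xy))
  ...   | inj₂ yx = tri> (asym-≺ (to yx)) x≢y (to yx)

-- `P` takes the prefix as an argument so that the recursion can move the first letter out of the
-- word and into the predicate.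
lookup-take-∷ʳ : ∀ {A : Set} (P : A → List A → Set) w x →
  (∀ i → P (lookup w i) (take (toℕ i) w)) → P x w →
  ∀ i → P (lookup (w ∷ʳ x) i) (take (toℕ i) (w ∷ʳ x))
lookup-take-∷ʳ P []      x Pw Px zero    = Px
lookup-take-∷ʳ P (y ∷ w) x Pw Px zero    = Pw zero
lookup-take-∷ʳ P (y ∷ w) x Pw Px (suc i) =
  lookup-take-∷ʳ (λ z u → P z (y ∷ u)) w x (Pw ∘ suc) Px i

-- Strong induction along the word. It is applied to π, with membership in the output as `P`.
∈-splitting : ∀ {A : Set} (P : A → Set) w →
  (∀ i → (∀ {y} → y ∈ take (toℕ i) w → P y) → P (lookup w i)) → ∀ {y} → y ∈ w → P y
∈-splitting P (z ∷ w) step = λ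
  { (here refl) → Pz
  ; (there y∈w) → ∈-splitting P w (λ i earlier → step (suc i)
      λ { (here refl) → Pz ; (there y∈) → earlier y∈ }) y∈w }
  where
  Pz : P z
  Pz = step zero λ ()

-- Histories

extractions : ∀ {A} → History A → List A
extractions []                = []
extractions (inserted x  ∷ h) = extractions h
extractions (extracted x ∷ h) = x ∷ extractions h

-- With values in `Fin 2`, the pattern of a history is itself a word, and patterns are counted by
-- `length-words`.
kind : ∀ {A} → Event A → Fin 2
kind (inserted _)  = zero
kind (extracted _) = suc zero

∈-insertions⁺ : ∀ {A} {x : A} {h} → inserted x ∈ h → x ∈ insertions h
∈-insertions⁺                     (here refl) = here refl
∈-insertions⁺ {h = inserted y ∷ h}  (there x∈h) = there (∈-insertions⁺ x∈h)
∈-insertions⁺ {h = extracted y ∷ h} (there x∈h) = ∈-insertions⁺ x∈h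

∈-insertions⁻ : ∀ {A} {x : A} h → x ∈ insertions h → inserted x ∈ h
∈-insertions⁻ (inserted y ∷ h)  (here refl) = here refl
∈-insertions⁻ (inserted y ∷ h)  (there x∈)  = there (∈-insertions⁻ h x∈)
∈-insertions⁻ (extracted y ∷ h) x∈          = there (∈-insertions⁻ h x∈)

∈-extractions⁺ : ∀ {A} {x : A} {h} → extracted x ∈ h → x ∈ extractions h
∈-extractions⁺                      (here refl) = here refl
∈-extractions⁺ {h = inserted y ∷ h}  (there x∈h) = ∈-extractions⁺ x∈h
∈-extractions⁺ {h = extracted y ∷ h} (there x∈h) = there (∈-extractions⁺ x∈h)

∈-extractions⁻ : ∀ {A} {x : A} h → x ∈ extractions h → extracted x ∈ h
∈-extractions⁻ (inserted y ∷ h)  x∈          = there (∈-extractions⁻ h x∈)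
∈-extractions⁻ (extracted y ∷ h) (here refl) = here refl
∈-extractions⁻ (extracted y ∷ h) (there x∈)  = there (∈-extractions⁻ h x∈)

length-insertions-extractions : ∀ {A} (h : History A) →
  length h ≡ length (insertions h) + length (extractions h)
length-insertions-extractions []                = refl
length-insertions-extractions (inserted x ∷ h)  = cong suc (length-insertions-extractions h)
length-insertions-extractions (extracted x ∷ h) =
  trans (cong suc (length-insertions-extractions h)) (sym (+-suc _ _))

-- The kinds tell, event by event, which of the two lists supplies the next letter.
interleaving-injective : ∀ {A} (g h : History A) → insertions g ≡ insertions h →
  extractions g ≡ extractions h → map kind g ≡ map kind h → g ≡ h
interleaving-injective []                []                _ _ _ = refl
interleaving-injective (inserted x ∷ g)  (inserted y ∷ h)  i e k
  with refl , i′ ← ∷-injective i =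
  cong (inserted x ∷_) (interleaving-injective g h i′ e (proj₂ (∷-injective k)))
interleaving-injective (extracted x ∷ g) (extracted y ∷ h) i e k
  with refl , e′ ← ∷-injective e =
  cong (extracted x ∷_) (interleaving-injective g h i e′ (proj₂ (∷-injective k)))
interleaving-injective (inserted x ∷ g)  (extracted y ∷ h) _ _ ()
interleaving-injective (extracted x ∷ g) (inserted y ∷ h)  _ _ ()

-- `workingSet` passes over extractions, so rescheduling them changes no w(x). This makes the
-- choices for different letters independent.
workingSet-insertions : ∀ {n} (g h : History (Fin n)) x →
  insertions g ≡ insertions h → workingSet g x ≡ workingSet h x
workingSet-insertions []                []                x _ = refl
workingSet-insertions (extracted _ ∷ g) h                 x i = workingSet-insertions g h x i
workingSet-insertions []                (extracted _ ∷ h) x i = workingSet-insertions [] h x i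
workingSet-insertions (inserted y ∷ g)  (extracted _ ∷ h) x i =
  workingSet-insertions (inserted y ∷ g) h x i
workingSet-insertions (inserted y ∷ g)  (inserted z ∷ h)  x i
  with refl , i′ ← ∷-injective i with does (x ≟ y)
... | true  = refl
... | false = cong suc (workingSet-insertions g h x i′)
workingSet-insertions []                (inserted z ∷ h)  x ()
workingSet-insertions (inserted y ∷ g)  []                x ()

-- The histories in which the extraction of x comes immediately after the
-- insertion of x or after a later insertion: one for each of the w(x)
-- elements counted by workingSet.
advance : ∀ {n} → Fin n → History (Fin n) → List (History (Fin n))
advance x []                = []
advance x (inserted y  ∷ h) = (extracted x ∷ inserted y ∷ h) ∷
  (if does (x ≟ y) then [] else map (inserted y ∷_) (advance x h))
advance x (extracted y ∷ h) = map (extracted y ∷_) (advance x h)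

-- The older events are rescheduled first, and each result then offers its own places for the next
-- extraction. For a run the choices multiply to ∏ w(x) over the extracted letters.
schedules : ∀ {n} → History (Fin n) → List (History (Fin n))
schedules []                = [ [] ]
schedules (inserted x  ∷ h) = map (inserted x ∷_) (schedules h)
schedules (extracted x ∷ h) = concatMap (advance x) (schedules h)

-- A left inverse of every choice made by `advance x`. It shows that different schedules stay
-- different after the extraction of `x` is placed.
unextract : ∀ {n} → Fin n → History (Fin n) → History (Fin n)
unextract x []                = []
unextract x (inserted y  ∷ h) = inserted y ∷ unextract x h
unextract x (extracted y ∷ h) =
  if does (x ≟ y) then h else extracted y ∷ unextract x h

length-advance : ∀ {n} (x : Fin n) h → length (advance x h) ≡ workingSet h x
length-advance x []                = refl
length-advance x (inserted y ∷ h)  with does (x ≟ y)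
... | true  = refl
... | false = cong suc (trans (length-map _ (advance x h)) (length-advance x h))
length-advance x (extracted y ∷ h) = trans (length-map _ (advance x h)) (length-advance x h)

-- Membership in `advance` as an inductive relation. The condition `x ≢ y` in `skipᵢ` keeps the
-- extraction of `x` from moving before the insertion of `x`.
data Advanced {n} (x : Fin n) : History (Fin n) → History (Fin n) → Set where
  now   : ∀ {y h} → Advanced x (inserted y ∷ h) (extracted x ∷ inserted y ∷ h)
  skipᵢ : ∀ {y h h′} → x ≢ y → Advanced x h h′ → Advanced x (inserted y ∷ h) (inserted y ∷ h′)
  skipₑ : ∀ {y h h′} → Advanced x h h′ → Advanced x (extracted y ∷ h) (extracted y ∷ h′)

∈-advance⁻ : ∀ {n} (x : Fin n) h {h′} → h′ ∈ advance x h → Advanced x h h′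
∈-advance⁻ x (inserted y ∷ h) (here refl) = now
∈-advance⁻ x (inserted y ∷ h) (there h′∈) with x ≟ y
... | no x≢y with _ , h″∈ , refl ← ∈-map⁻ (inserted y ∷_) h′∈ = skipᵢ x≢y (∈-advance⁻ x h h″∈)
∈-advance⁻ x (extracted y ∷ h) h′∈
  with _ , h″∈ , refl ← ∈-map⁻ (extracted y ∷_) h′∈ = skipₑ (∈-advance⁻ x h h″∈)

module _ {n} {x : Fin n} where

  advanced-insertions : ∀ {h h′} → Advanced x h h′ → insertions h′ ≡ insertions h
  advanced-insertions now           = refl
  advanced-insertions (skipᵢ _ adv) = cong (_ ∷_) (advanced-insertions adv)
  advanced-insertions (skipₑ adv)   = advanced-insertions adv

  advanced-extractions : ∀ {h h′} → Advanced x h h′ → extractions h′ ↭ x ∷ extractions h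
  advanced-extractions now           = ↭-refl
  advanced-extractions (skipᵢ _ adv) = advanced-extractions adv
  advanced-extractions (skipₑ adv)   =
    ↭-trans (prep _ (advanced-extractions adv)) (swap _ _ ↭-refl)

  -- As `h` does not extract `x`, the first extraction of `x` met in `h′` is the one that was placed
  -- there.
  unextract-advanced : ∀ {h h′} → Advanced x h h′ → x ∉ extractions h → unextract x h′ ≡ h
  unextract-advanced now x∉ with x ≟ x
  ... | yes _  = refl
  ... | no x≢x = ⊥-elim (x≢x refl)
  unextract-advanced (skipᵢ _ adv) x∉ = cong (_ ∷_) (unextract-advanced adv x∉)
  unextract-advanced (skipₑ {y} adv) x∉ with x ≟ y
  ... | yes refl = ⊥-elim (x∉ (here refl))
  ... | no _     = cong (_ ∷_) (unextract-advanced adv (x∉ ∘ there))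

Unique-advance : ∀ {n} (x : Fin n) h → Unique (advance x h)
Unique-advance x []               = []
Unique-advance x (inserted y ∷ h) = All.tabulate fresh ∷ rest
  where
  fresh : ∀ {h′} → h′ ∈ (if does (x ≟ y) then [] else map (inserted y ∷_) (advance x h)) →
          extracted x ∷ inserted y ∷ h ≢ h′
  fresh h′∈ refl with does (x ≟ y)
  ... | false with _ , _ , () ← ∈-map⁻ (inserted y ∷_) h′∈
  rest : Unique (if does (x ≟ y) then [] else map (inserted y ∷_) (advance x h))
  rest with does (x ≟ y)
  ... | true  = []
  ... | false = Uniqueₚ.map⁺ (proj₂ ∘ ∷-injective) (Unique-advance x h)
Unique-advance x (extracted y ∷ h) = Uniqueₚ.map⁺ (proj₂ ∘ ∷-injective) (Unique-advance x h)

-- Rescheduling the extractions of an execution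

module _ {n} (S : MPS n) where

  -- The histories of queues that only receive enabled letters, with arbitrary
  -- present letters extracted instead of minima.
  data Run : History (Fin n) → Set where
    []  : Run []
    ins : ∀ {x h} → Run h → x ∉ insertions h →
          p S x (support (extractions h)) ≡ true → Run (inserted x ∷ h)
    ext : ∀ {x h} → Run h → x ∈ insertions h → x ∉ extractions h → Run (extracted x ∷ h)

  -- Words enter only through their sets of letters, so this also covers a list of extractions that
  -- is permuted or reversed.
  p-monotone : ∀ {x} v w → (∀ {y} → y ∈ v → y ∈ w) → x ∉ w →
    p S x (support v) ≡ true → p S x (support w) ≡ true
  p-monotone {x} v w v⊆w x∉w pv
    with p S x (support v) | p S x (support w)
       | monotone S x (support v) (support w)
           (λ y∈ → ∈-support⁺ (v⊆w (∈-support⁻ v y∈))) (x∉w ∘ ∈-support⁻ w)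
  ... | true | true | _ = refl

  Unique-insertions : ∀ {h} → Run h → Unique (insertions h)
  Unique-insertions []             = []
  Unique-insertions (ins r x∉ _)   =
    All.tabulate (λ { y∈ refl → x∉ y∈ }) ∷ Unique-insertions r
  Unique-insertions (ext r _ _)    = Unique-insertions r

  Unique-extractions : ∀ {h} → Run h → Unique (extractions h)
  Unique-extractions []           = []
  Unique-extractions (ins r _ _)  = Unique-extractions r
  Unique-extractions (ext r _ x∉) =
    All.tabulate (λ { y∈ refl → x∉ y∈ }) ∷ Unique-extractions r

  extractions⊆insertions : ∀ {h} → Run h → ∀ {x} → x ∈ extractions h → x ∈ insertions h
  extractions⊆insertions (ins r _ _)  x∈          = there (extractions⊆insertions r x∈)
  extractions⊆insertions (ext r x∈ _) (here refl) = x∈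
  extractions⊆insertions (ext r _ _)  (there x∈)  = extractions⊆insertions r x∈

  -- A letter is enabled when inserted, and extractions of other letters only enlarge the set on
  -- which `p` is evaluated. Hence it stays enabled for as long as it is present.
  present⇒p : ∀ {h} → Run h → ∀ {x} → x ∈ insertions h → x ∉ extractions h →
    p S x (support (extractions h)) ≡ true
  present⇒p (ins r _ px) (here refl) x∉ = px
  present⇒p (ins r _ _)  (there x∈)  x∉ = present⇒p r x∈ x∉
  present⇒p (ext {y} {h} r _ _) x∈   x∉ =
    p-monotone (extractions h) (y ∷ extractions h) there x∉ (present⇒p r x∈ (x∉ ∘ there))

  -- Events newer than the placed extraction now see `x` as extracted. An insertion of `y` stays
  -- legal by monotonicity, since `y` differs from `x` and has not been extracted before. An
  -- extraction of `y` stays legal because `x` is not extracted in `h`, so again `y` differs from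
  -- `x`.
  advanced-run : ∀ {x h h′} → Advanced x h h′ → Run h →
    x ∈ insertions h → x ∉ extractions h → Run h′
  advanced-run now r x∈ x∉ = ext r x∈ x∉
  advanced-run {x} (skipᵢ {y} {h} {h′} x≢y adv) (ins r y∉ py) x∈ x∉ =
    ins (advanced-run adv r (older x∈) x∉) (y∉ ∘ subst (y ∈_) (advanced-insertions adv))
      (p-monotone (extractions h) (extractions h′)
        (∈-resp-↭ (↭-sym (advanced-extractions adv)) ∘ there) y∉′ py)
    where
    older : x ∈ y ∷ insertions h → x ∈ insertions h
    older (here refl) = ⊥-elim (x≢y refl)
    older (there x∈h) = x∈h
    y∉′ : y ∉ extractions h′
    y∉′ y∈ with ∈-resp-↭ (advanced-extractions adv) y∈
    ... | here refl = x≢y refl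
    ... | there y∈h = y∉ (extractions⊆insertions r y∈h)
  advanced-run {x} (skipₑ {y} {h} {h′} adv) (ext r y∈ y∉) x∈ x∉ =
    ext (advanced-run adv r x∈ (x∉ ∘ there))
      (subst (y ∈_) (sym (advanced-insertions adv)) y∈) y∉′
    where
    y∉′ : y ∉ extractions h′
    y∉′ y∈′ with ∈-resp-↭ (advanced-extractions adv) y∈′
    ... | here refl = x∉ (here refl)
    ... | there y∈h = y∉ y∈h

  -- The insertions keep their order, which fixes all working sets. The extractions may be
  -- reordered, and this order is what is counted in 𝒫(S).
  record Schedule (h g : History (Fin n)) : Set where
    field
      run              : Run g
      same-insertions  : insertions g ≡ insertions h
      same-extractions : extractions g ↭ extractions h

  open Schedule

  ∈-schedules⁻ : ∀ {h} → Run h → ∀ {g} → g ∈ schedules h → Schedule h g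
  ∈-schedules⁻ [] (here refl) = record
    { run = [] ; same-insertions = refl ; same-extractions = ↭-refl }
  ∈-schedules⁻ (ins {x} {h} r x∉ px) g∈
    with g , g∈′ , refl ← ∈-map⁻ (inserted x ∷_) g∈ = record
    -- The rescheduled past has extracted the same letters in another order, so `x` is still
    -- enabled.
    { run = ins (run s) (x∉ ∘ subst (x ∈_) (same-insertions s))
        (p-monotone (extractions h) (extractions g) (∈-resp-↭ (↭-sym (same-extractions s)))
          (x∉ ∘ extractions⊆insertions r ∘ ∈-resp-↭ (same-extractions s)) px)
    ; same-insertions  = cong (x ∷_) (same-insertions s)
    ; same-extractions = same-extractions s
    }
    where s = ∈-schedules⁻ r g∈′
  ∈-schedules⁻ (ext {x} {h} r x∈ x∉) g∈
    with g , g∈′ , g′∈ ← ∈-concatMap⇒∃ (advance x) (schedules h) g∈ = record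
    { run = advanced-run adv (run s) (subst (x ∈_) (sym (same-insertions s)) x∈)
              (x∉ ∘ ∈-resp-↭ (same-extractions s))
    ; same-insertions  = trans (advanced-insertions adv) (same-insertions s)
    ; same-extractions = ↭-trans (advanced-extractions adv) (prep x (same-extractions s))
    }
    where
    s   = ∈-schedules⁻ r g∈′
    adv = ∈-advance⁻ x g g′∈

  Unique-schedules : ∀ {h} → Run h → Unique (schedules h)
  Unique-schedules []            = [] ∷ []
  Unique-schedules (ins r _ _)   = Uniqueₚ.map⁺ (proj₂ ∘ ∷-injective) (Unique-schedules r)
  Unique-schedules (ext {x} {h} r x∈ x∉) =
    -- `unextract x` recovers `g` because `g` extracts the same letters as `h`, and `x` is not among
    -- them.
    Unique-concatMap (advance x) (unextract x) (Unique-schedules r)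
      (λ {g} _ → Unique-advance x g)
      λ {g} g∈ g′∈ → unextract-advanced (∈-advance⁻ x g g′∈)
        (x∉ ∘ ∈-resp-↭ (same-extractions (∈-schedules⁻ r g∈)))

  -- Each schedule of `h` has the insertions of `h` and therefore contributes the same number w(x)
  -- of placements.
  length-schedules-extracted : ∀ {h} → Run h → ∀ x →
    length (schedules (extracted x ∷ h)) ≡ length (schedules h) * workingSet h x
  length-schedules-extracted {h} r x = length-concatMap (advance x) (workingSet h x)
    λ {g} g∈ → trans (length-advance x g)
      (workingSet-insertions g h x (same-insertions (∈-schedules⁻ r g∈)))

  -- Extraction orders as elements of 𝒫(S), and the number of schedules

  run⇒∈ℒ : ∀ {h} → Run h → reverse (extractions h) ∈ℒ S
  run⇒∈ℒ {h} r = Unique-resp-↭ (↭-sym (↭-reverse (extractions h))) (Unique-extractions r) , go r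
    where
    Allowed : Fin n → Word n → Set
    Allowed x w = p S x (support w) ≡ true
    go : ∀ {h} → Run h → let w = reverse (extractions h) in
      ∀ i → Allowed (lookup w i) (take (toℕ i) w)
    go (ins r _ _) = go r
    -- Histories list the latest event first, so `x` ends the reversed word. Being present before
    -- its extraction, it is allowed after the letters extracted earlier.
    go (ext {x} {h} r x∈ x∉) rewrite unfold-reverse x (extractions h) =
      lookup-take-∷ʳ Allowed (reverse (extractions h)) x (go r)
        (p-monotone (extractions h) (reverse (extractions h))
          (∈-resp-↭ (↭-sym (↭-reverse (extractions h))))
          (x∉ ∘ ∈-resp-↭ (↭-reverse (extractions h)))
          (present⇒p r x∈ x∉))

  run⇒∈𝒫 : ∀ {h} → Run h → (∀ x → x ∈ extractions h) → reverse (extractions h) ∈𝒫 S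
  run⇒∈𝒫 {h} r full =
    (proj₁ (run⇒∈ℒ r) , λ x → ∈-resp-↭ (↭-sym (↭-reverse (extractions h))) (full x)) , run⇒∈ℒ r

  ∈𝒫⇒∈filter : ∀ {w} → w ∈𝒫 S → w ∈ filter (_∈𝒫? S) (words n n)
  ∈𝒫⇒∈filter {w} w∈𝒫@((uw , full) , _) =
    ∈-filter⁺ (_∈𝒫? S) (subst (λ k → w ∈ words n k) length≡n (∈-words w)) w∈𝒫
    where
    length≡n : length w ≡ n
    -- A simple word has at most `n` letters, and one that contains every letter has at least `n`.
    length≡n = ≤-antisym (Unique⇒length≤ uw)
      (subst (_≤ length w) (length-tabulate {n = n} id)
        (injection⇒length≤ id (Uniqueₚ.allFin⁺ n) (λ {x} _ → full x) (λ _ _ → id)))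

  schedules-bound : ∀ {h} → Run h → (∀ x → x ∈ extractions h) →
    length (schedules h) ≤ ∣𝒫 S ∣ * 2 ^ length h
  schedules-bound {h} r full = begin
    length (schedules h)                ≤⟨ injection⇒length≤ encode (Unique-schedules r) into inj ⟩
    length (cartesianProduct perms (words 2 (length h)))
                                        ≡⟨ length-cartesianProductWith _,_ perms (words 2 (length h)) ⟩
    ∣𝒫 S ∣ * length (words 2 (length h)) ≡⟨ cong (∣𝒫 S ∣ *_) (length-words 2 (length h)) ⟩
    ∣𝒫 S ∣ * 2 ^ length h               ∎
    where
    open ≤-Reasoning
    perms : List (Word n)
    perms = filter (_∈𝒫? S) (words n n)
    encode : History (Fin n) → Word n × Word 2
    encode g = reverse (extractions g) , map kind g
    -- All schedules have as many events as `h`, so their patterns lie in a single set of size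
    -- `2 ^ length h`.
    length-kinds : ∀ {g} → Schedule h g → length (map kind g) ≡ length h
    length-kinds {g} s = begin-equality
      length (map kind g) ≡⟨ length-map kind g ⟩
      length g            ≡⟨ length-insertions-extractions g ⟩
      length (insertions g) + length (extractions g)
        ≡⟨ cong₂ _+_ (cong length (same-insertions s)) (↭-length (same-extractions s)) ⟩
      length (insertions h) + length (extractions h)
        ≡⟨ length-insertions-extractions h ⟨
      length h            ∎
    into : ∀ {g} → g ∈ schedules h → encode g ∈ cartesianProduct perms (words 2 (length h))
    into {g} g∈ = ∈-cartesianProduct⁺
      (∈𝒫⇒∈filter (run⇒∈𝒫 (run s) λ x → ∈-resp-↭ (↭-sym (same-extractions s)) (full x)))
      (subst (λ k → map kind g ∈ words 2 k) (length-kinds s) (∈-words (map kind g)))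
      where s = ∈-schedules⁻ r g∈
    inj : ∀ {f g} → f ∈ schedules h → g ∈ schedules h → encode f ≡ encode g → f ≡ g
    inj {f} {g} f∈ g∈ eq = interleaving-injective f g
      (trans (same-insertions (∈-schedules⁻ r f∈)) (sym (same-insertions (∈-schedules⁻ r g∈))))
      (reverse-injective (cong proj₁ eq)) (cong proj₂ eq)

  -- The amortized time in terms of the number of schedules

  amortized≡ : ∀ a b {h} → Run h → antilog (amortized a b h) ≡
    2 ^ (a * length (insertions h)) * (2 ^ length (extractions h) * length (schedules h)) ^ b
  amortized≡ a b [] rewrite *-zeroʳ a | ^-zeroˡ b = refl
  amortized≡ a b (ins {x} {h} r _ _) = begin
    antilog (amortized a b h) * 2 ^ a ≡⟨ cong (_* 2 ^ a) (amortized≡ a b r) ⟩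
    2 ^ (a * i) * X L * 2 ^ a         ≡⟨ solve 3 (λ u v w → u :* v :* w := w :* u :* v) refl
                                           (2 ^ (a * i)) (X L) (2 ^ a) ⟩
    2 ^ a * 2 ^ (a * i) * X L         ≡⟨ cong₂ (λ u l → u * X l) (^-distribˡ-+-* 2 a (a * i))
                                           (length-map (inserted x ∷_) (schedules h)) ⟨
    2 ^ (a + a * i) * X L′            ≡⟨ cong (λ k → 2 ^ k * X L′) (*-suc a i) ⟨
    2 ^ (a * suc i) * X L′            ∎
    where
    open ≡-Reasoning
    open +-*-Solver
    i = length (insertions h)
    L = length (schedules h)
    L′ = length (schedules (inserted x ∷ h))
    X : ℕ → ℕ
    X l = (2 ^ length (extractions h) * l) ^ b
  -- Extracting `x` contributes the factor (2 w(x))^b. The 2 joins the power of two that counts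
  -- extractions, and w(x) joins the number of schedules.
  amortized≡ a b (ext {x} {h} r _ _)
    rewrite amortized≡ a b r | length-schedules-extracted r x = begin
      (A * (E * L) ^ b) * (2 * w) ^ b ≡⟨ *-assoc A _ _ ⟩
      A * ((E * L) ^ b * (2 * w) ^ b) ≡⟨ cong (A *_) (^-distribʳ-* b (E * L) (2 * w)) ⟨
      A * (E * L * (2 * w)) ^ b       ≡⟨ cong (λ m → A * m ^ b) (rearrange E L w) ⟩
      A * (2 * E * (L * w)) ^ b       ∎
    where
    open ≡-Reasoning
    open +-*-Solver
    A = 2 ^ (a * length (insertions h))
    E = 2 ^ length (extractions h)
    L = length (schedules h)
    w = workingSet h x
    rearrange : ∀ E L w → E * L * (2 * w) ≡ 2 * E * (L * w)
    rearrange = solve 3 (λ E L w → E :* L :* (con 2 :* w) := con 2 :* E :* (L :* w)) refl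

  -- With N = 2^n, at most `n` insertions cost N^a. Inside the power `b` stand one N for the
  -- constant term of the extractions, two more for the at most 2n bits of the pattern, and P for
  -- the extraction orders. The three factors N give the coefficient 3.
  amortized-bound : ∀ a b {h} → Run h → (∀ x → x ∈ extractions h) → 1 ≤ ∣𝒫 S ∣ →
    amortized a b h ≤ᴸ (a + 3 * b) · (fromℕ n +ᴸ log₂ ∣𝒫 S ∣)
  amortized-bound a b {h} r full 1≤P = begin
    antilog (amortized a b h)             ≡⟨ amortized≡ a b r ⟩
    2 ^ (a * i) * (2 ^ e * length (schedules h)) ^ b
      ≤⟨ *-mono-≤ (^-monoʳ-≤ 2 (*-monoʳ-≤ a i≤n)) (^-monoˡ-≤ b
           (*-mono-≤ (^-monoʳ-≤ 2 e≤n) (≤-trans (schedules-bound r full)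
             (*-monoʳ-≤ P (^-monoʳ-≤ 2 length≤))))) ⟩
    2 ^ (a * n) * (N * (P * 2 ^ (n + n))) ^ b
      ≡⟨ cong₂ (λ u v → u * (N * (P * v)) ^ b)
           (trans (cong (2 ^_) (*-comm a n)) (sym (^-*-assoc 2 n a))) (^-distribˡ-+-* 2 n n) ⟩
    N ^ a * (N * (P * (N * N))) ^ b
      ≤⟨ *-mono-≤ (^-monoˡ-≤ a N≤M) (^-monoˡ-≤ b (step N P 1≤P)) ⟩
    M ^ a * (M ^ 3) ^ b                   ≡⟨ cong (M ^ a *_) (^-*-assoc M 3 b) ⟩
    M ^ a * M ^ (3 * b)                   ≡⟨ ^-distribˡ-+-* M a (3 * b) ⟨
    M ^ (a + 3 * b)                       ∎
    where
    open ≤-Reasoning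
    P = ∣𝒫 S ∣
    N = 2 ^ n
    M = N * P
    i = length (insertions h)
    e = length (extractions h)
    i≤n : i ≤ n
    i≤n = Unique⇒length≤ (Unique-insertions r)
    e≤n : e ≤ n
    e≤n = Unique⇒length≤ (Unique-extractions r)
    length≤ : length h ≤ n + n
    length≤ = subst (_≤ n + n) (sym (length-insertions-extractions h)) (+-mono-≤ i≤n e≤n)
    N≤M : N ≤ M
    N≤M = subst (_≤ M) (*-identityʳ N) (*-monoʳ-≤ N 1≤P)
    -- Two further factors P, each at least 1, complete the cube of N P.
    step : ∀ N P → 1 ≤ P → N * (P * (N * N)) ≤ (N * P) ^ 3
    step N P 1≤P = begin
      N * (P * (N * N))              ≡⟨ *-identityʳ _ ⟨
      N * (P * (N * N)) * 1          ≤⟨ *-monoʳ-≤ (N * (P * (N * N))) (*-mono-≤ 1≤P 1≤P) ⟩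
      N * (P * (N * N)) * (P * P)    ≡⟨ solve 2 (λ N P → N :* (P :* (N :* N)) :* (P :* P)
                                          := (N :* P) :* ((N :* P) :* ((N :* P) :* con 1))) refl N P ⟩
      (N * P) ^ 3                    ∎
      where open +-*-Solver

-- Executions of topological heapsort

extractMin-history : ∀ {A} {Q : PriorityQueue A} {lt} (C : Configuration Q) {x C′} →
  extractMin lt C ≡ just (x , C′) → history C′ ≡ extracted x ∷ history C
extractMin-history {Q = Q} {lt} (config s h t) eq
  with result lt (PriorityQueue.extractMin Q s)
extractMin-history (config s h t) refl | just _ = refl

module _ {n} {Q : PriorityQueue (Fin n)} (isPQ : IsPriorityQueue Q) (S : MPS n)
         {π : Word n} (π∈𝒫 : π ∈𝒫 S) where

  open DecMembership (_≟_ {n}) using (_∈?_)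

  private
    ≺ : Fin n → Fin n → Bool
    ≺ = precedes π

    ≺-total : StrictTotal ≺
    ≺-total = precedes-strictTotal (proj₁ π∈𝒫)

  record Inserted (xs : List (Fin n)) (C C′ : Configuration Q) : Set where
    field
      reachable         : Reachable ≺ C′
      run               : Run S (history C′)
      extractions-fixed : extractions (history C′) ≡ extractions (history C)
      old-inserted      : ∀ {y} → y ∈ insertions (history C) → y ∈ insertions (history C′)
      new-inserted      : ∀ {y} → y ∈ xs → y ∈ insertions (history C′)

  -- Insertions leave the extractions unchanged, so letters enabled at the start of a batch are
  -- still enabled when their turn comes.
  insertAll-run : ∀ {xs} (C : Configuration Q) → Reachable ≺ C → Run S (history C) → Unique xs →
    (∀ {x} → x ∈ xs → x ∉ insertions (history C)) →
    (∀ {x} → x ∈ xs → p S x (support (extractions (history C))) ≡ true) →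
    Inserted xs C (insertAll ≺ C xs)
  insertAll-run C reach r [] _ _ = record
    { reachable = reach ; run = r ; extractions-fixed = refl
    ; old-inserted = id ; new-inserted = λ () }
  insertAll-run {x ∷ xs} C reach r (x∉xs ∷ uxs) fresh px = record
    { reachable         = I.reachable
    ; run               = I.run
    ; extractions-fixed = I.extractions-fixed
    ; old-inserted      = I.old-inserted ∘ there
    ; new-inserted      = λ { (here refl) → I.old-inserted (here refl)
                            ; (there y∈)  → I.new-inserted y∈ }
    }
    where
    fresh′ : ∀ {y} → y ∈ xs → y ∉ x ∷ insertions (history C)
    fresh′ y∈ (here refl) = All.lookup x∉xs y∈ refl
    fresh′ y∈ (there y∈C) = fresh (there y∈) y∈C
    module I = Inserted (insertAll-run (insert ≺ C x) (insertion x reach)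
      (ins r (fresh (here refl)) (px (here refl))) uxs fresh′ (px ∘ there))

  -- The output and the extractions are compared as sets, which is all that `support` sees. Through
  -- `enabled⇒inserted`, an empty queue will imply a complete output.
  record LoopInvariant (α : Word n) (C : Configuration Q) : Set where
    field
      reachable : Reachable ≺ C
      run       : Run S (history C)
      extracted⇒output : ∀ {y} → y ∈ extractions (history C) → y ∈ α
      output⇒extracted : ∀ {y} → y ∈ α → y ∈ extractions (history C)
      enabled⇒inserted : ∀ {y} → y ∉ α → p S y (support α) ≡ true → y ∈ insertions (history C)

  loopInvariant : ∀ {α C} → AtLoopHead Q S π α C → LoopInvariant α C
  loopInvariant (initialize (uxs , enum)) = record
    { reachable        = I.reachable
    ; run              = I.run
    ; extracted⇒output = subst (_ ∈_) I.extractions-fixed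
    ; output⇒extracted = λ ()
    ; enabled⇒inserted = λ {y} _ py → I.new-inserted (Equivalence.from (enum y) py)
    }
    where
    module I = Inserted (insertAll-run new start [] uxs (λ _ ())
      (λ {x} x∈ → Equivalence.to (enum x) x∈))
  loopInvariant (iterate {α} {C} {x} {C′} {ys} loop eq (uys , enum)) = record
    { reachable        = I.reachable
    ; run              = I.run
    ; extracted⇒output = to-output ∘ subst (_ ∈_) I.extractions-fixed
    ; output⇒extracted = λ y∈ → subst (_ ∈_) (sym I.extractions-fixed) (from-output y∈)
    ; enabled⇒inserted = enabled
    }
    where
    module L = LoopInvariant (loopInvariant loop)
    hist : history C′ ≡ extracted x ∷ history C
    hist = extractMin-history C eq
    -- A minimum is in particular present, which makes its extraction a legal step of a `Run`.
    present : Present (history C) x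
    present = proj₁ (IsPriorityQueue.minimum isPQ ≺-total L.reachable
      (Unique-insertions S L.run) eq)
    run′ : Run S (history C′)
    run′ = subst (Run S) (sym hist) (ext L.run (∈-insertions⁺ (proj₁ present))
      (proj₂ present ∘ ∈-extractions⁻ (history C)))
    to-output : ∀ {y} → y ∈ extractions (history C′) → y ∈ α ∷ʳ x
    to-output y∈ with subst (λ h → _ ∈ extractions h) hist y∈
    ... | here refl = ∈-++⁺ʳ α (here refl)
    ... | there y∈C = ∈-++⁺ˡ (L.extracted⇒output y∈C)
    from-output : ∀ {y} → y ∈ α ∷ʳ x → y ∈ extractions (history C′)
    from-output y∈ = subst (λ h → _ ∈ extractions h) (sym hist)
      ([ there ∘ L.output⇒extracted , (λ { (here refl) → here refl }) ]′ (∈-++⁻ α y∈))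
    -- A letter inserted earlier is either still present or already output, and the scan excludes
    -- both.
    fresh : ∀ {y} → y ∈ ys → y ∉ insertions (history C′)
    fresh {y} y∈ys y∈C′ with y∉α , absent , _ ← Equivalence.to (enum y) y∈ys =
      absent (∈-insertions⁻ (history C′) y∈C′ , y∉α ∘ to-output ∘ ∈-extractions⁺)
    allowed : ∀ {y} → y ∈ ys → p S y (support (extractions (history C′))) ≡ true
    allowed {y} y∈ys with y∉α , _ , py ← Equivalence.to (enum y) y∈ys =
      p-monotone S (α ∷ʳ x) (extractions (history C′)) from-output (y∉α ∘ to-output) py
    module I = Inserted (insertAll-run C′ (deletion L.reachable eq) run′ uys fresh allowed)
    enabled : ∀ {y} → y ∉ α ∷ʳ x → p S y (support (α ∷ʳ x)) ≡ true →
      y ∈ insertions (history (insertAll ≺ C′ ys))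
    enabled {y} y∉ py with y ∈? insertions (history C′)
    ... | yes y∈C′ = I.old-inserted y∈C′
    ... | no y∉C′  = I.new-inserted (Equivalence.from (enum y)
      (y∉ , y∉C′ ∘ ∈-insertions⁺ ∘ proj₁ , py))

  -- Follow π. If all letters before some letter of π are output, that letter is enabled after its
  -- prefix in π, hence by monotonicity after α unless it is in α. If it were not in α, it would
  -- still be in the queue, which is empty.
  heapsort-complete : ∀ {α C} → Heapsort Q S π α C → ∀ x → x ∈ extractions (history C)
  heapsort-complete {α} {C} (loop , drained) x =
    L.output⇒extracted (∈-splitting (_∈ α) π step (proj₂ (proj₁ π∈𝒫) x))
    where
    module L = LoopInvariant (loopInvariant loop)
    step : ∀ i → (∀ {y} → y ∈ take (toℕ i) π → y ∈ α) → lookup π i ∈ α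
    step i earlier with lookup π i ∈? α
    ... | yes y∈α = y∈α
    ... | no y∉α  = ⊥-elim (drained (lookup π i)
      ( ∈-insertions⁻ (history C) (L.enabled⇒inserted y∉α
          (p-monotone S (take (toℕ i) π) α earlier y∉α (proj₂ (proj₂ π∈𝒫) i)))
      , y∉α ∘ L.extracted⇒output ∘ ∈-extractions⁺))

theorem5 : ∀ (a b : ℕ) → ∃[ c ]
    (∀ (n : ℕ) → NonZero n →
    ∀ (Q : PriorityQueue (Fin n)) → IsPriorityQueue Q → WeakWorkingSetProperty Q a b →
    ∀ (S : MPS n) (π : Word n) → π ∈𝒫 S →
    ∀ (α : Word n) (C : Configuration Q) → Heapsort Q S π α C →
    fromℕ (time C) ≤ᴸ c · (fromℕ n +ᴸ log₂ ∣𝒫 S ∣))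
-- The constant comes from `amortized-bound`, applied to the history of the final queue. The listing
-- of π among the permutations shows that |𝒫(S)| is at least 1.
theorem5 a b = a + 3 * b , λ n _ Q isPQ workingSetBound S π π∈𝒫 α C heapsort →
  let open LoopInvariant (loopInvariant isPQ S π∈𝒫 (proj₁ heapsort)) in
  ≤-trans
    (workingSetBound (precedes-strictTotal (proj₁ π∈𝒫)) reachable (Unique-insertions S run))
    (amortized-bound S a b run (heapsort-complete isPQ S π∈𝒫 heapsort)
      (∈-length (∈𝒫⇒∈filter S π∈𝒫)))
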